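{- Let $f_i\in F_i$. Then every feasible (integer) solution $x$ of the MILP $P$ satisfies the inequality $$\sum_m\Delta_i^m(f_i)\,s_m+\sum_n\Delta_i^n(f_i)\,x_n\ \ge\ \omega_i(f_i),\qquad s_m=\sum_n c_{m,n}x_n-b_m .$$ Moreover, adding this single inequality to the linear problem $P_l$ increases the optimal objective value by at least $\omega_i(f_i)$, i.e. every $x$ that is feasible for $P_l$ and satisfies the inequality has $\sum_n c_nx_n\ge\omega_0+\omega_i(f_i)$.
   Context: Linear problem. $P_l$ is the linear program: minimize $\sum_n c_n x_n$ subject to $\sum_n c_{m,n}x_n\ge b_m$ for all $m$, and $x_n\ge 0$ for all $n$ (finitely many real variables $x_n$ and inequalities indexed by $m$; the index sets $\{m\}$ and $\{n\}$ are taken disjoint, and $r$ denotes an index running over their union). It has finite optimal value $\omega_0$. Its dual solution space is $V_0=\{y: y_m\ge 0\ \forall m,\ r_n(y)\ge 0\ \forall n\}$, where $r_n(y)=c_n-\sum_m c_{m,n}y_m$ is the reduced cost of $x_n$, and its dual objective is $\omega(y)=\sum_m b_m y_m$ (to be maximized). Fix an optimal dual solution $y$, so $\omega(y)=\omega_0$. MILP and case differentiation. $P$ is the mixed integer linear program obtained from $P_l$ by requiring certain of the variables $x_n$ to be integers. A case differentiation $i$ with a finite nonempty set of cases $j\in J_i$ is given. Case $j$ consists of finitely many additional linear inequalities $\sum_n d^{i,j}_{k,n}x_n\ge e^{i,j}_k$ (indexed by $k$), and every feasible point of $P$ satisfies all inequalities of at least one case $j\in J_i$. Cases. $V_{i,j}$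 is the dual solution space of $P_l$ with the inequalities of case $(i,j)$ added: the set of pairs $(v,z)$ with $v_m\ge0$, $z_k\ge 0$ and $r_n(v,z):=c_n-\sum_m c_{m,n}v_m-\sum_k d^{i,j}_{k,n}z_k\ge 0$ for all $m,k,n$. Its objective is the linear function $\omega_{i,j}(v,z)=\sum_m b_mv_m+\sum_k e^{i,j}_kz_k$. The vector $y$ is identified with $(y,0)$. Put $P_{i,j}=\{w\in V_{i,j}:\omega_{i,j}(w)\ge\omega_0\}$ and $C_{i,j}=\{c: y+c\in P_{i,j}\}$. For $c_{i,j}\in C_{i,j}$ the value $\omega_{i,j}(c_{i,j})$ is that of the linear function $\omega_{i,j}$ at $c_{i,j}$, i.e. $\omega_{i,j}(y+c_{i,j})-\omega_{i,j}(y)$. Define $\Delta^m_{i,j}(c_{i,j})=y_m-(y+c_{i,j})_m=-(c_{i,j})_m$ for every row index $m$ of $P_l$, and $\Delta^n_{i,j}(c_{i,j})=r_n(y)-r_n(y+c_{i,j})$ for every column index $n$. Together these are $\Delta^r_{i,j}(c_{i,j})$. File. $F_i=\bigoplus_{j\in J_i}C_{i,j}$, i.e. an element $f_i\in F_i$ is a family $(c_{i,j})_{j\in J_i}$ with $c_{i,j}\in C_{i,j}$. Define $\omega_i(f_i)=\min_{j}\omega_{i,j}(c_{i,j})$ and $\Delta_i^r(f_i)=\max_{j}\Delta^r_{i,j}(c_{i,j})$. -}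

module Defs where

open import Level using (Level; suc)
open import Algebra.Apartness.Bundles using (HeytingCommutativeRing; HeytingField)
open import Algebra.Bundles using (CommutativeRing)
import Algebra.Properties.CommutativeMonoid.Sum as Sum
import Algebra.Properties.Monoid.Mult as Mult
open import Data.Fin.Base using (Fin)
open import Data.Fin.Subset using (Subset; _∈_)
open import Data.Integer.Base using (ℤ; +_; -[1+_])
open import Data.Nat.Base as ℕ using (ℕ)
open import Data.Product.Base using (_×_; _,_; ∃; ∃-syntax; Σ-syntax; proj₁; proj₂)
open import Data.Sum.Base using (_⊎_; inj₁; inj₂)
open import Data.Vec.Functional using (Vector; head; tail; foldr; zipWith; replicate)
open import Function.Bundles using (_⇔_)
open import Relation.Binary.Core using (Rel)
open import Relation.Binary.Lattice.Structures using (IsLattice)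
open import Relation.Binary.Structures using (IsStrictPartialOrder)
open import Relation.Nullary.Negation using (¬_)

-- Totality of _≤_ is not an axiom, since it is not constructively valid for ℝ;
-- cotransitivity of _<_ comes from that of _#_, and 1# # 0# holds in every
-- HeytingField because 1# - 0# is invertible.
record OrderedField (c ℓ : Level) : Set (suc (c Level.⊔ ℓ)) where
  field
    heytingField : HeytingField c ℓ ℓ

  open HeytingField heytingField public

  infix  4 _<_ _≤_
  infixl 6 _⊔_
  infixl 7 _⊓_

  field
    _<_ _≤_              : Rel Carrier ℓ
    _⊔_ _⊓_              : Carrier → Carrier → Carrier
    isStrictPartialOrder : IsStrictPartialOrder _≈_ _<_
    isLattice            : IsLattice _≈_ _≤_ _⊔_ _⊓_
    ≤⇔≯                  : ∀ {x y} → x ≤ y ⇔ (¬ y < x)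
    #⇔<⊎>                : ∀ {x y} → x # y ⇔ (x < y ⊎ y < x)
    +-monoˡ-<            : ∀ z {x y} → x < y → x + z < y + z
    *-positive           : ∀ {x y} → 0# < x → 0# < y → 0# < x * y

  commutativeRing : CommutativeRing c ℓ
  commutativeRing = HeytingCommutativeRing.commutativeRing heytingCommutativeRing

  open CommutativeRing commutativeRing public using (+-monoid; +-commutativeMonoid)

  fromℕ : ℕ → Carrier
  fromℕ n = Mult._×_ +-monoid n 1#

  fromℤ : ℤ → Carrier
  fromℤ (+ n)    = fromℕ n
  fromℤ -[1+ n ] = - fromℕ (ℕ.suc n)

-- The real numbers, axiomatised as a Cauchy-complete Archimedean ordered
-- field.  Classically these axioms determine ℝ up to isomorphism.
record RealNumbers (c ℓ : Level) : Set (suc (c Level.⊔ ℓ)) where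
  field
    orderedField : OrderedField c ℓ

  open OrderedField orderedField public

  -- The two indices range independently, so no absolute value is needed.
  IsCauchy : (ℕ → Carrier) → Set _
  IsCauchy s = ∀ ε → 0# < ε →
    ∃ λ k → (∀ p q → k ℕ.≤ p → k ℕ.≤ q → s p - s q < ε)

  ConvergesTo : (ℕ → Carrier) → Carrier → Set _
  ConvergesTo s l = ∀ ε → 0# < ε →
    ∃ λ k → (∀ p → k ℕ.≤ p → (s p - l < ε) × (l - s p < ε))

  field
    archimedean : ∀ x → ∃[ n ] x < fromℕ n
    complete    : ∀ s → IsCauchy s → ∃[ l ] ConvergesTo s l

module CaseDifferentiations {c ℓ} (R : RealNumbers c ℓ) where

  open RealNumbers R renaming (Carrier to ℝ) public
  open Sum +-commutativeMonoid using (sum; sum-syntax) public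

  infix 8 _·_
  _·_ : ∀ {n} → Vector ℝ n → Vector ℝ n → ℝ
  _·_ {n} u v = ∑[ i < n ] (u i * v i)

  minimum : ∀ {n} → Vector ℝ (ℕ.suc n) → ℝ
  minimum u = foldr _⊓_ (head u) (tail u)

  maximum : ∀ {n} → Vector ℝ (ℕ.suc n) → ℝ
  maximum u = foldr _⊔_ (head u) (tail u)

  IsInteger : ℝ → Set ℓ
  IsInteger a = ∃[ k ] a ≈ fromℤ k

  -- Minimise cost · x subject to A m · x ≥ b m and x ≥ 0.
  record LinearProgram (M N : ℕ) : Set c where
    field
      A    : Fin M → Vector ℝ N
      b    : Vector ℝ M
      cost : Vector ℝ N

  module _ {M N : ℕ} (Pₗ : LinearProgram M N) where
    open LinearProgram Pₗ

    Feasible : Vector ℝ N → Set ℓ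
    Feasible x = (∀ m → b m ≤ A m · x) × (∀ n → 0# ≤ x n)

    objective : Vector ℝ N → ℝ
    objective x = cost · x

    surplus : Vector ℝ N → Vector ℝ M
    surplus x m = A m · x - b m

    -- The infimum of the objective over the feasible points; its being a real
    -- number excludes both infeasible and unbounded programs.
    IsOptimalValue : ℝ → Set (c Level.⊔ ℓ)
    IsOptimalValue ω₀ =
      (∀ x → Feasible x → ω₀ ≤ objective x) ×
      (∀ a → (∀ x → Feasible x → a ≤ objective x) → a ≤ ω₀)

    reducedCost : Vector ℝ M → Vector ℝ N
    reducedCost y n = cost n - ∑[ m < M ] (A m n * y m)

    DualFeasible : Vector ℝ M → Set ℓ
    DualFeasible y = (∀ m → 0# ≤ y m) × (∀ n → 0# ≤ reducedCost y n)

    dualObjective : Vector ℝ M → ℝ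
    dualObjective y = b · y

    IsDualOptimal : Vector ℝ M → Set (c Level.⊔ ℓ)
    IsDualOptimal y =
      DualFeasible y × (∀ y′ → DualFeasible y′ → dualObjective y′ ≤ dualObjective y)

  record MILP (M N : ℕ) : Set c where
    field
      relaxation      : LinearProgram M N
      integerIndices  : Subset N

  FeasibleMILP : ∀ {M N} → MILP M N → Vector ℝ N → Set ℓ
  FeasibleMILP P x =
    Feasible relaxation x × (∀ n → n ∈ integerIndices → IsInteger (x n))
    where open MILP P

  record Case (N : ℕ) : Set c where
    field
      {K} : ℕ
      d   : Fin K → Vector ℝ N
      e   : Vector ℝ K

  SatisfiesCase : ∀ {N} → Case N → Vector ℝ N → Set ℓ
  SatisfiesCase C x = ∀ k → e k ≤ d k · x
    where open Case C

  record CaseDifferentiation {M N : ℕ} (P : MILP M N) : Set (c Level.⊔ ℓ) where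
    field
      {pred#cases} : ℕ

    J : Set
    J = Fin (ℕ.suc pred#cases)

    field
      case       : J → Case N
      exhaustive : ∀ x → FeasibleMILP P x → ∃[ j ] SatisfiesCase (case j) x

  module _ {M N : ℕ} (Pₗ : LinearProgram M N) (C : Case N) where
    open LinearProgram Pₗ
    open Case C

    CaseDualVector : Set c
    CaseDualVector = Vector ℝ M × Vector ℝ K

    caseReducedCost : CaseDualVector → Vector ℝ N
    caseReducedCost (v , z) n =
      cost n - ∑[ m < M ] (A m n * v m) - ∑[ k < K ] (d k n * z k)

    CaseDualFeasible : CaseDualVector → Set ℓ
    CaseDualFeasible (v , z) =
      (∀ m → 0# ≤ v m) × (∀ k → 0# ≤ z k) × (∀ n → 0# ≤ caseReducedCost (v , z) n)

    caseDualObjective : CaseDualVector → ℝ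
    caseDualObjective (v , z) = b · v + e · z

    embed : Vector ℝ M → CaseDualVector
    embed y = y , replicate K 0#

    infixl 6 _⊕_
    _⊕_ : CaseDualVector → CaseDualVector → CaseDualVector
    (v , z) ⊕ (v′ , z′) = zipWith _+_ v v′ , zipWith _+_ z z′

    -- Membership in P_{i,j}.
    InCasePolyhedron : ℝ → CaseDualVector → Set ℓ
    InCasePolyhedron ω₀ w = CaseDualFeasible w × ω₀ ≤ caseDualObjective w

    -- The set C_{i,j}.
    CaseChange : ℝ → Vector ℝ M → Set (c Level.⊔ ℓ)
    CaseChange ω₀ y = Σ[ w ∈ CaseDualVector ] InCasePolyhedron ω₀ (embed y ⊕ w)

    -- Row indices are the left summand, column indices the right one.
    caseΔ : Vector ℝ M → CaseDualVector → Fin M ⊎ Fin N → ℝ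
    caseΔ y w (inj₁ m) = y m - proj₁ (embed y ⊕ w) m
    caseΔ y w (inj₂ n) = reducedCost Pₗ y n - caseReducedCost (embed y ⊕ w) n

  module _ {M N : ℕ} {P : MILP M N} (D : CaseDifferentiation P)
           (ω₀ : ℝ) (y : Vector ℝ M) where
    open MILP P
    open CaseDifferentiation D

    -- The set F_i.
    File : Set (c Level.⊔ ℓ)
    File = ∀ j → CaseChange relaxation (case j) ω₀ y

    fileω : File → ℝ
    fileω f = minimum λ j → caseDualObjective relaxation (case j) (proj₁ (f j))

    fileΔ : File → Fin M ⊎ Fin N → ℝ
    fileΔ f r = maximum λ j → caseΔ relaxation (case j) y (proj₁ (f j)) r

    FileInequality : File → Vector ℝ N → Set ℓ
    FileInequality f x =
      fileω f ≤ ∑[ m < M ] (fileΔ f (inj₁ m) * surplus relaxation x m)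
              + ∑[ n < N ] (fileΔ f (inj₂ n) * x n)

{-# OPTIONS --safe #-}

-- Pair a vector (u , r) indexed by rows and columns with a point x through
-- ⟪ u , r ⟫ = u · s + r · x, which is monotone on feasible points.  The objective
-- at x decomposes as ⟪ y , r(y) ⟫ + b · y, and likewise, for w = (v , z) in case j,
-- as ⟪ v , r(w) ⟫ + b · v + z · (d x).  Comparing the two evaluates ⟪ Δⱼ ⟫, which
-- dominates ωⱼ at the points of case j; this is the validity of the cut.  For the
-- bound, each Δⱼ is at most (y , r(y)) because v and r(w) are nonnegative, so the
-- first decomposition bounds the objective below by ω₀ plus the left-hand side
-- of the cut.
module Submission where

open import Algebra.Bundles using (CommutativeRing)
import Algebra.Apartness.Properties.HeytingCommutativeRing as HeytingProperties
import Algebra.Properties.CommutativeSemigroup as CommutativeSemigroupProperties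
import Algebra.Properties.Semiring.Sum as SemiringSum
open import Data.Fin.Base using (Fin; zero; suc)
open import Data.Nat.Base as ℕ using (ℕ)
open import Data.Product.Base using (_×_; _,_; proj₁; proj₂)
open import Data.Sum.Base using (_⊎_; inj₁; inj₂; [_,_])
open import Data.Vec.Functional using (Vector; foldr; head; tail)
open import Function.Base using (_∘_)
open import Function.Bundles using (Equivalence)
open import Relation.Binary.Bundles using (Poset)
open import Relation.Binary.Lattice.Structures using (IsLattice)
import Relation.Binary.Reasoning.PartialOrder as PosetReasoning
import Relation.Binary.Reasoning.Setoid as SetoidReasoning
open import Relation.Binary.Structures using (IsStrictPartialOrder)
open import Relation.Nullary.Negation using (¬_; contradiction)
open import Defs

-- Constructive order arithmetic.

module OrderedFieldProperties {c ℓ} (F : OrderedField c ℓ) where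

  open OrderedField F hiding (zero)
  open CommutativeRing commutativeRing
    using (semiring; *-commutativeSemigroup)
  open HeytingProperties heytingCommutativeRing using (x-0≈x; invertibleʳ⇒#)
  open CommutativeSemigroupProperties *-commutativeSemigroup using () renaming (x∙yz≈y∙xz to *-leftComm)
  open SemiringSum semiring
  open IsStrictPartialOrder isStrictPartialOrder
    using (<-respˡ-≈; <-respʳ-≈) renaming (irrefl to <-irrefl; trans to <-trans)
  open IsLattice isLattice public
    using (isPartialOrder; x≤x∨y; y≤x∨y; x∧y≤x; x∧y≤y; ∨-least)
    renaming (refl to ≤-refl; trans to ≤-trans; reflexive to ≤-reflexive)

  poset : Poset c ℓ ℓ
  poset = record { isPartialOrder = isPartialOrder }

  private
    variable
      w x y z : Carrier
      n : ℕ

  ≮⇒≥ : ¬ y < x → x ≤ y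
  ≮⇒≥ = Equivalence.from ≤⇔≯

  ≤⇒≯ : x ≤ y → ¬ y < x
  ≤⇒≯ = Equivalence.to ≤⇔≯

  x-y+y≈x : ∀ x y → x - y + y ≈ x
  x-y+y≈x x y = begin
    x - y + y      ≈⟨ +-assoc x (- y) y ⟩
    x + (- y + y)  ≈⟨ +-congˡ (-‿inverseˡ y) ⟩
    x + 0#         ≈⟨ +-identityʳ x ⟩
    x              ∎
    where open SetoidReasoning setoid

  x+y-y≈x : ∀ x y → x + y - y ≈ x
  x+y-y≈x x y = begin
    x + y - y      ≈⟨ +-assoc x y (- y) ⟩
    x + (y - y)    ≈⟨ +-congˡ (-‿inverseʳ y) ⟩
    x + 0#         ≈⟨ +-identityʳ x ⟩
    x              ∎
    where open SetoidReasoning setoid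

  +-cancelʳ-< : ∀ z → x + z < y + z → x < y
  +-cancelʳ-< z x+z<y+z =
    <-respˡ-≈ (x+y-y≈x _ z) (<-respʳ-≈ (x+y-y≈x _ z) (+-monoˡ-< (- z) x+z<y+z))

  -- `x ≤ y` is the negation of `y < x`, so a law for `_≤_` is the contrapositive of the converse
  -- law for `_<_`: cancellation comes from strict monotonicity, and monotonicity from strict
  -- cancellation.
  +-cancelʳ-≤ : ∀ z → x + z ≤ y + z → x ≤ y
  +-cancelʳ-≤ z x+z≤y+z = ≮⇒≥ (≤⇒≯ x+z≤y+z ∘ +-monoˡ-< z)

  +-monoˡ-≤ : ∀ z → x ≤ y → x + z ≤ y + z
  +-monoˡ-≤ z x≤y = ≮⇒≥ (≤⇒≯ x≤y ∘ +-cancelʳ-< z)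

  +-monoʳ-≤ : ∀ z → x ≤ y → z + x ≤ z + y
  +-monoʳ-≤ {x} {y} z x≤y = begin
    z + x  ≈⟨ +-comm z x ⟩
    x + z  ≤⟨ +-monoˡ-≤ z x≤y ⟩
    y + z  ≈⟨ +-comm y z ⟩
    z + y  ∎
    where open PosetReasoning poset

  +-mono-≤ : w ≤ x → y ≤ z → w + y ≤ x + z
  +-mono-≤ {x = x} {y = y} w≤x y≤z = ≤-trans (+-monoˡ-≤ y w≤x) (+-monoʳ-≤ x y≤z)

  x≤y⇒0≤y-x : x ≤ y → 0# ≤ y - x
  x≤y⇒0≤y-x {x} {y} x≤y = begin
    0#     ≈⟨ -‿inverseʳ x ⟨
    x - x  ≤⟨ +-monoˡ-≤ (- x) x≤y ⟩
    y - x  ∎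
    where open PosetReasoning poset

  0≤y⇒x-y≤x : 0# ≤ y → x - y ≤ x
  0≤y⇒x-y≤x {y} {x} 0≤y = begin
    x - y       ≈⟨ +-identityʳ (x - y) ⟨
    x - y + 0#  ≤⟨ +-monoʳ-≤ (x - y) 0≤y ⟩
    x - y + y   ≈⟨ x-y+y≈x x y ⟩
    x           ∎
    where open PosetReasoning poset

  -- Apartness from `0#` is invertibility of the difference with `0#`, and an inverse of `x * y`
  -- multiplied by `y` is an inverse of `x`.
  #0-factorˡ : x * y # 0# → x # 0#
  #0-factorˡ {x} {y} xy#0 with #⇒invertible xy#0
  ... | xy⁻¹ , _ , xy*xy⁻¹≈1 = invertibleʳ⇒# (y * xy⁻¹ , (begin
    (x - 0#) * (y * xy⁻¹)  ≈⟨ *-congʳ (x-0≈x x) ⟩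
    x * (y * xy⁻¹)         ≈⟨ *-assoc x y xy⁻¹ ⟨
    x * y * xy⁻¹           ≈⟨ *-congʳ (x-0≈x (x * y)) ⟨
    (x * y - 0#) * xy⁻¹    ≈⟨ xy*xy⁻¹≈1 ⟩
    1#                     ∎))
    where open SetoidReasoning setoid

  0≤∧#0⇒0< : 0# ≤ x → x # 0# → 0# < x
  0≤∧#0⇒0< 0≤x x#0 with Equivalence.to #⇔<⊎> x#0
  ... | inj₁ x<0 = contradiction x<0 (≤⇒≯ 0≤x)
  ... | inj₂ 0<x = 0<x

  -- _≤_ is a negative statement, so x * y < 0# may be assumed; then x * y # 0#,
  -- which makes both factors apart from 0# and hence positive.
  *-nonNegative : 0# ≤ x → 0# ≤ y → 0# ≤ x * y
  *-nonNegative {x} {y} 0≤x 0≤y = ≮⇒≥ λ xy<0 →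
    let xy#0 = Equivalence.from #⇔<⊎> (inj₁ xy<0)
        yx#0 = Equivalence.from #⇔<⊎> (inj₁ (<-respˡ-≈ (*-comm x y) xy<0))
        0<xy = *-positive (0≤∧#0⇒0< 0≤x (#0-factorˡ xy#0)) (0≤∧#0⇒0< 0≤y (#0-factorˡ yx#0))
    in <-irrefl refl (<-trans 0<xy xy<0)

  *-monoˡ-≤ : 0# ≤ z → x ≤ y → x * z ≤ y * z
  *-monoˡ-≤ {z} {x} {y} 0≤z x≤y = begin
    x * z                ≈⟨ +-identityˡ (x * z) ⟨
    0# + x * z           ≤⟨ +-monoˡ-≤ (x * z) (*-nonNegative (x≤y⇒0≤y-x x≤y) 0≤z) ⟩
    (y - x) * z + x * z  ≈⟨ distribʳ z (y - x) x ⟨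
    (y - x + x) * z      ≈⟨ *-congʳ (x-y+y≈x y x) ⟩
    y * z                ∎
    where open PosetReasoning poset

  -- Finite sums.

  sum-mono-≤ : ∀ {n} {u v : Vector Carrier n} → (∀ i → u i ≤ v i) → sum u ≤ sum v
  sum-mono-≤ {ℕ.zero}  u≤v = ≤-refl
  sum-mono-≤ {ℕ.suc n} u≤v = +-mono-≤ (u≤v zero) (sum-mono-≤ (u≤v ∘ suc))

  ∑-distrib-+-* : (u v t : Vector Carrier n) →
    ∑[ i < n ] ((u i + v i) * t i) ≈ ∑[ i < n ] (u i * t i) + ∑[ i < n ] (v i * t i)
  ∑-distrib-+-* u v t = trans
    (sum-cong-≋ λ i → distribʳ (t i) (u i) (v i))
    (∑-distrib-+ (λ i → u i * t i) (λ i → v i * t i))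

  -- The adjunction between `B` and its transpose, by exchanging the sums. It turns the column sums
  -- inside reduced costs into multiples of the row values at a point.
  ∑-transpose : ∀ {m n} (B : Fin m → Vector Carrier n) (u : Vector Carrier m) (t : Vector Carrier n) →
    ∑[ j < n ] ((∑[ i < m ] (B i j * u i)) * t j) ≈ ∑[ i < m ] (u i * ∑[ j < n ] (B i j * t j))
  ∑-transpose {m} {n} B u t = begin
    ∑[ j < n ] ((∑[ i < m ] (B i j * u i)) * t j)  ≈⟨ sum-cong-≋ (λ j → *-distribʳ-sum (t j) λ i → B i j * u i) ⟩
    ∑[ j < n ] ∑[ i < m ] (B i j * u i * t j)      ≈⟨ ∑-comm (λ j i → B i j * u i * t j) ⟩
    ∑[ i < m ] ∑[ j < n ] (B i j * u i * t j)      ≈⟨ sum-cong-≋ (λ i → sum-cong-≋ λ j → *-rotate i j) ⟩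
    ∑[ i < m ] ∑[ j < n ] (u i * (B i j * t j))    ≈⟨ sum-cong-≋ (λ i → *-distribˡ-sum (u i) λ j → B i j * t j) ⟨
    ∑[ i < m ] (u i * ∑[ j < n ] (B i j * t j))    ∎
    where
    open SetoidReasoning setoid
    *-rotate : ∀ i j → B i j * u i * t j ≈ u i * (B i j * t j)
    *-rotate i j = trans (*-assoc (B i j) (u i) (t j)) (*-leftComm (B i j) (u i) (t j))

  -- Bounds for iterated meets and joins.

  foldr-⊓-≤-init : ∀ z (u : Vector Carrier n) → foldr _⊓_ z u ≤ z
  foldr-⊓-≤-init {ℕ.zero}  z u = ≤-refl
  foldr-⊓-≤-init {ℕ.suc n} z u = ≤-trans (x∧y≤y _ _) (foldr-⊓-≤-init z (tail u))

  foldr-⊓-≤ : ∀ z (u : Vector Carrier n) i → foldr _⊓_ z u ≤ u i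
  foldr-⊓-≤ z u zero    = x∧y≤x _ _
  foldr-⊓-≤ z u (suc i) = ≤-trans (x∧y≤y _ _) (foldr-⊓-≤ z (tail u) i)

  init-≤-foldr-⊔ : ∀ z (u : Vector Carrier n) → z ≤ foldr _⊔_ z u
  init-≤-foldr-⊔ {ℕ.zero}  z u = ≤-refl
  init-≤-foldr-⊔ {ℕ.suc n} z u = ≤-trans (init-≤-foldr-⊔ z (tail u)) (y≤x∨y _ _)

  ≤-foldr-⊔ : ∀ z (u : Vector Carrier n) i → u i ≤ foldr _⊔_ z u
  ≤-foldr-⊔ z u zero    = x≤x∨y _ _
  ≤-foldr-⊔ z u (suc i) = ≤-trans (≤-foldr-⊔ z (tail u) i) (y≤x∨y _ _)

  foldr-⊔-least : ∀ {z} {u : Vector Carrier n} → z ≤ x → (∀ i → u i ≤ x) → foldr _⊔_ z u ≤ x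
  foldr-⊔-least {ℕ.zero}  z≤x u≤x = z≤x
  foldr-⊔-least {ℕ.suc n} z≤x u≤x = ∨-least (u≤x zero) (foldr-⊔-least z≤x (u≤x ∘ suc))

module CaseDifferentiationProperties {c ℓ} (R : RealNumbers c ℓ) where

  open CaseDifferentiations R hiding (zero)
  open OrderedFieldProperties orderedField
  open CommutativeRing commutativeRing using (semiring; +-commutativeSemigroup)
  open CommutativeSemigroupProperties +-commutativeSemigroup
    using (interchange; x∙yz≈yx∙z; xy∙z≈xz∙y)
  open SemiringSum semiring using (sum-cong-≋; ∑-distrib-+)

  minimum-≤ : ∀ {n} (u : Vector ℝ (ℕ.suc n)) i → minimum u ≤ u i
  -- `minimum` folds over the tail starting from the head, so index `zero` is the initial value of
  -- the fold and not one of its entries.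
  minimum-≤ u zero    = foldr-⊓-≤-init (head u) (tail u)
  minimum-≤ u (suc i) = foldr-⊓-≤ (head u) (tail u) i

  ≤-maximum : ∀ {n} (u : Vector ℝ (ℕ.suc n)) i → u i ≤ maximum u
  ≤-maximum u zero    = init-≤-foldr-⊔ (head u) (tail u)
  ≤-maximum u (suc i) = ≤-foldr-⊔ (head u) (tail u) i

  maximum-least : ∀ {n a} {u : Vector ℝ (ℕ.suc n)} → (∀ i → u i ≤ a) → maximum u ≤ a
  maximum-least u≤a = foldr-⊔-least (u≤a zero) (u≤a ∘ suc)

  ·-congˡ : ∀ {n} {u v : Vector ℝ n} (t : Vector ℝ n) → (∀ i → u i ≈ v i) → u · t ≈ v · t
  ·-congˡ t u≈v = sum-cong-≋ λ i → *-congʳ (u≈v i)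

  ·-comm : ∀ {n} (u v : Vector ℝ n) → u · v ≈ v · u
  ·-comm u v = sum-cong-≋ λ i → *-comm (u i) (v i)

  ·-monoˡ-≤ : ∀ {n} {u v t : Vector ℝ n} →
    (∀ i → 0# ≤ t i) → (∀ i → u i ≤ v i) → u · t ≤ v · t
  ·-monoˡ-≤ 0≤t u≤v = sum-mono-≤ λ i → *-monoˡ-≤ (0≤t i) (u≤v i)

  -- Pairings and the decomposition of the objective.

  module _ {M N : ℕ} (Pₗ : LinearProgram M N) where
    open LinearProgram Pₗ

    -- At `fileΔ` this is definitionally the right-hand side of `FileInequality`, so estimates of
    -- pairings are estimates of the cut.
    pairing : (Fin M ⊎ Fin N → ℝ) → Vector ℝ N → ℝ
    pairing u x = (u ∘ inj₁) · surplus Pₗ x + (u ∘ inj₂) · x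

    -- Feasibility says exactly that both kinds of weight, the surpluses and the coordinates of `x`,
    -- are nonnegative.
    pairing-mono-≤ : ∀ {u u′ x} → Feasible Pₗ x → (∀ r → u r ≤ u′ r) → pairing u x ≤ pairing u′ x
    pairing-mono-≤ (b≤Ax , 0≤x) u≤u′ = +-mono-≤
      (·-monoˡ-≤ (x≤y⇒0≤y-x ∘ b≤Ax) (u≤u′ ∘ inj₁))
      (·-monoˡ-≤ 0≤x (u≤u′ ∘ inj₂))

    pairing-cong : ∀ {u u′} x → (∀ r → u r ≈ u′ r) → pairing u x ≈ pairing u′ x
    pairing-cong x u≈u′ =
      +-cong (·-congˡ (surplus Pₗ x) (u≈u′ ∘ inj₁)) (·-congˡ x (u≈u′ ∘ inj₂))

    pairing-+ : ∀ u u′ x → pairing (λ r → u r + u′ r) x ≈ pairing u x + pairing u′ x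
    pairing-+ u u′ x = trans
      (+-cong (∑-distrib-+-* (u ∘ inj₁) (u′ ∘ inj₁) (surplus Pₗ x))
              (∑-distrib-+-* (u ∘ inj₂) (u′ ∘ inj₂) x))
      (interchange _ _ _ _)

    dualValues : Vector ℝ M → Fin M ⊎ Fin N → ℝ
    dualValues y = [ y , reducedCost Pₗ y ]

    ·-surplus : ∀ y x → y · (λ m → A m · x) ≈ y · surplus Pₗ x + b · y
    ·-surplus y x = begin
      y · (λ m → A m · x)              ≈⟨ sum-cong-≋ (λ m → *-congˡ (x-y+y≈x (A m · x) (b m))) ⟨
      y · (λ m → surplus Pₗ x m + b m)  ≈⟨ sum-cong-≋ (λ m → distribˡ (y m) (surplus Pₗ x m) (b m)) ⟩
      ∑[ m < M ] (y m * surplus Pₗ x m + y m * b m)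
                                       ≈⟨ ∑-distrib-+ (λ m → y m * surplus Pₗ x m) (λ m → y m * b m) ⟩
      y · surplus Pₗ x + y · b          ≈⟨ +-congˡ (·-comm y b) ⟩
      y · surplus Pₗ x + b · y          ∎
      where open SetoidReasoning setoid

    -- Split `cost` into reduced cost plus `Aᵀy`, transpose, and split `A m · x` into surplus plus
    -- `b m`. This is an identity in `y` and `x`; for dual feasible `y` and feasible `x` the pairing
    -- is nonnegative, which gives weak duality.
    objective-decomposition : ∀ y x → objective Pₗ x ≈ pairing (dualValues y) x + b · y
    objective-decomposition y x = begin
      cost · x                                                ≈⟨ ·-congˡ x (λ n → x-y+y≈x (cost n) (Aᵀy n)) ⟨
      (λ n → reducedCost Pₗ y n + Aᵀy n) · x                   ≈⟨ ∑-distrib-+-* (reducedCost Pₗ y) Aᵀy x ⟩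
      reducedCost Pₗ y · x + Aᵀy · x                           ≈⟨ +-congˡ (∑-transpose A y x) ⟩
      reducedCost Pₗ y · x + y · (λ m → A m · x)               ≈⟨ +-congˡ (·-surplus y x) ⟩
      reducedCost Pₗ y · x + (y · surplus Pₗ x + b · y)         ≈⟨ x∙yz≈yx∙z _ _ _ ⟩
      y · surplus Pₗ x + reducedCost Pₗ y · x + b · y           ∎
      where
      open SetoidReasoning setoid
      Aᵀy : Vector ℝ N
      Aᵀy n = ∑[ m < M ] (A m n * y m)

    -- Comparison with the dual of one case.

    module _ (C : Case N) where
      open Case C

      caseDualValues : CaseDualVector Pₗ C → Fin M ⊎ Fin N → ℝ
      caseDualValues w = [ proj₁ w , caseReducedCost Pₗ C w ]

      -- The decomposition at `v`, with the multiples of the case rows moved out of its reduced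
      -- costs. Case rows have no coordinate in the pairing, so their values at `x` stay as a
      -- separate term, to be compared with `e · z`.
      objective-case-decomposition : ∀ v z x →
        objective Pₗ x ≈ pairing (caseDualValues (v , z)) x + (b · v + z · (λ k → d k · x))
      objective-case-decomposition v z x = begin
        objective Pₗ x                                       ≈⟨ objective-decomposition v x ⟩
        vs + reducedCost Pₗ v · x + b · v                    ≈⟨ +-congʳ (+-congˡ reducedCost-split) ⟩
        vs + (rx + zdx) + b · v                             ≈⟨ +-congʳ (+-assoc vs rx zdx) ⟨
        vs + rx + zdx + b · v                               ≈⟨ +-assoc (vs + rx) zdx (b · v) ⟩
        vs + rx + (zdx + b · v)                             ≈⟨ +-congˡ (+-comm zdx (b · v)) ⟩
        vs + rx + (b · v + zdx)                             ∎
        where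
        open SetoidReasoning setoid
        r Dᵀz : Vector ℝ N
        r = caseReducedCost Pₗ C (v , z)
        Dᵀz n = ∑[ k < K ] (d k n * z k)
        vs rx zdx : ℝ
        vs = v · surplus Pₗ x
        rx = r · x
        zdx = z · (λ k → d k · x)
        reducedCost-split : reducedCost Pₗ v · x ≈ rx + zdx
        reducedCost-split = begin
          reducedCost Pₗ v · x        ≈⟨ ·-congˡ x (λ n → x-y+y≈x (reducedCost Pₗ v n) (Dᵀz n)) ⟨
          (λ n → r n + Dᵀz n) · x    ≈⟨ ∑-distrib-+-* r Dᵀz x ⟩
          rx + Dᵀz · x               ≈⟨ +-congˡ (∑-transpose d z x) ⟩
          rx + zdx                   ∎

      module _ (y : Vector ℝ M) (w : CaseDualVector Pₗ C) where

        private
          y⊕w : CaseDualVector Pₗ C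
          y⊕w = _⊕_ Pₗ C (embed Pₗ C y) w

        dualValues-split : ∀ r → caseΔ Pₗ C y w r + caseDualValues y⊕w r ≈ dualValues y r
        dualValues-split (inj₁ m) = x-y+y≈x _ _
        dualValues-split (inj₂ n) = x-y+y≈x _ _

        caseΔ≤dualValues : CaseDualFeasible Pₗ C y⊕w → ∀ r → caseΔ Pₗ C y w r ≤ dualValues y r
        caseΔ≤dualValues (0≤v , _ , 0≤r) (inj₁ m) = 0≤y⇒x-y≤x (0≤v m)
        caseΔ≤dualValues (0≤v , _ , 0≤r) (inj₂ n) = 0≤y⇒x-y≤x (0≤r n)

        -- Linearity of the case objective: the embedded `y` has zero multipliers on the case rows,
        -- so it contributes `b · y` alone.
        caseDualObjective-shift :
          b · proj₁ y⊕w + e · proj₂ y⊕w ≈ caseDualObjective Pₗ C w + b · y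
        caseDualObjective-shift = begin
          b · proj₁ y⊕w + e · proj₂ y⊕w  ≈⟨ +-cong b·-split (sum-cong-≋ λ k → *-congˡ (+-identityˡ (proj₂ w k))) ⟩
          b · y + b · v + e · proj₂ w    ≈⟨ +-assoc _ _ _ ⟩
          b · y + (b · v + e · proj₂ w)  ≈⟨ +-comm _ _ ⟩
          b · v + e · proj₂ w + b · y    ∎
          where
          open SetoidReasoning setoid
          v : Vector ℝ M
          v = proj₁ w
          b·-split : b · (λ m → y m + v m) ≈ b · y + b · v
          b·-split = trans (sum-cong-≋ λ m → distribˡ (b m) (y m) (v m))
                           (∑-distrib-+ (λ m → b m * y m) (λ m → b m * v m))

        caseDualObjective≤pairing-caseΔ : CaseDualFeasible Pₗ C y⊕w →
          ∀ x → SatisfiesCase C x → caseDualObjective Pₗ C w ≤ pairing (caseΔ Pₗ C y w) x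
        caseDualObjective≤pairing-caseΔ (_ , 0≤z , _) x e≤dx =
          -- The two decompositions are subtracted by cancellation: with `b · y` and `q` added, the
          -- right side becomes the decomposition at `y`, and the left side the one at `y⊕w` with
          -- `e` in place of the case rows at `x`.
          +-cancelʳ-≤ (b · y) (+-cancelʳ-≤ q (begin
            caseDualObjective Pₗ C w + b · y + q                ≈⟨ +-congʳ caseDualObjective-shift ⟨
            -- The only inequality of the chain: nonnegative multipliers weight the inequalities of
            -- the case.
            b · proj₁ y⊕w + e · proj₂ y⊕w + q                  ≤⟨ +-monoˡ-≤ q (+-monoʳ-≤ _ e·z≤dx·z) ⟩
            b · proj₁ y⊕w + proj₂ y⊕w · (λ k → d k · x) + q    ≈⟨ +-comm _ q ⟩
            q + (b · proj₁ y⊕w + proj₂ y⊕w · (λ k → d k · x))  ≈⟨ objective-case-decomposition (proj₁ y⊕w) (proj₂ y⊕w) x ⟨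
            objective Pₗ x                                      ≈⟨ objective-decomposition y x ⟩
            pairing (dualValues y) x + b · y                   ≈⟨ +-congʳ (pairing-cong x dualValues-split) ⟨
            pairing (λ r → caseΔ Pₗ C y w r + caseDualValues y⊕w r) x + b · y
                                                               ≈⟨ +-congʳ (pairing-+ (caseΔ Pₗ C y w) (caseDualValues y⊕w) x) ⟩
            pairing (caseΔ Pₗ C y w) x + q + b · y              ≈⟨ xy∙z≈xz∙y _ q (b · y) ⟩
            pairing (caseΔ Pₗ C y w) x + b · y + q              ∎))
          where
          open PosetReasoning poset
          q : ℝ
          q = pairing (caseDualValues y⊕w) x
          e·z≤dx·z : e · proj₂ y⊕w ≤ proj₂ y⊕w · (λ k → d k · x)
          e·z≤dx·z = ≤-trans (·-monoˡ-≤ 0≤z e≤dx) (≤-reflexive (·-comm (λ k → d k · x) (proj₂ y⊕w)))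

  -- Validity and strength of the file inequality.

  module _ {M N} (P : MILP M N) (ω₀ : ℝ) (y : Vector ℝ M)
           (D : CaseDifferentiation P) (f : File D ω₀ y) where
    open MILP P
    open CaseDifferentiation D

    -- The satisfied case `j` depends on `x`. Taking the minimum of the bounds and the maximum of
    -- the coefficients weakens the inequality of each case to one common inequality.
    fileInequality-valid : ∀ x → FeasibleMILP P x → FileInequality D ω₀ y f x
    fileInequality-valid x feasible with exhaustive x feasible
    ... | j , x∈j = begin
      fileω D ω₀ y f
        ≤⟨ minimum-≤ (λ j → caseDualObjective relaxation (case j) (proj₁ (f j))) j ⟩
      caseDualObjective relaxation (case j) (proj₁ (f j))
        ≤⟨ caseDualObjective≤pairing-caseΔ relaxation (case j) y (proj₁ (f j)) (proj₁ (proj₂ (f j))) x x∈j ⟩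
      pairing relaxation (caseΔ relaxation (case j) y (proj₁ (f j))) x
        ≤⟨ pairing-mono-≤ relaxation (proj₁ feasible)
             (λ r → ≤-maximum (λ j → caseΔ relaxation (case j) y (proj₁ (f j)) r) j) ⟩
      pairing relaxation (fileΔ D ω₀ y f) x
        ∎
      where open PosetReasoning poset

    fileInequality-bound : dualObjective relaxation y ≈ ω₀ →
      ∀ x → Feasible relaxation x → FileInequality D ω₀ y f x →
      ω₀ + fileω D ω₀ y f ≤ objective relaxation x
    fileInequality-bound b·y≈ω₀ x feasible cut = begin
      ω₀ + fileω D ω₀ y f
        ≤⟨ +-monoʳ-≤ ω₀ cut ⟩
      ω₀ + pairing relaxation (fileΔ D ω₀ y f) x
        ≤⟨ +-monoʳ-≤ ω₀ (pairing-mono-≤ relaxation feasible fileΔ≤dualValues) ⟩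
      ω₀ + pairing relaxation (dualValues relaxation y) x
        ≈⟨ +-comm ω₀ _ ⟩
      pairing relaxation (dualValues relaxation y) x + ω₀
        ≈⟨ +-congˡ b·y≈ω₀ ⟨
      pairing relaxation (dualValues relaxation y) x + dualObjective relaxation y
        ≈⟨ objective-decomposition relaxation y x ⟨
      objective relaxation x
        ∎
      where
      open PosetReasoning poset
      fileΔ≤dualValues : ∀ r → fileΔ D ω₀ y f r ≤ dualValues relaxation y r
      -- The bound by the values at `y` is the same for every case, so it passes to the least upper
      -- bound.
      fileΔ≤dualValues r = maximum-least λ j →
        caseΔ≤dualValues relaxation (case j) y (proj₁ (f j)) (proj₁ (proj₂ (f j))) r

theorem6p4 : ∀ {c ℓ} (R : RealNumbers c ℓ) →
    let open CaseDifferentiations R in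
    ∀ {M N} (P : MILP M N) →
    let open MILP P in
    ∀ (ω₀ : ℝ) → IsOptimalValue relaxation ω₀ →
    ∀ (y : Vector ℝ M) → IsDualOptimal relaxation y → dualObjective relaxation y ≈ ω₀ →
    ∀ (D : CaseDifferentiation P) (f : File D ω₀ y) →
    (∀ x → FeasibleMILP P x → FileInequality D ω₀ y f x) ×
    (∀ x → Feasible relaxation x → FileInequality D ω₀ y f x →
    ω₀ + fileω D ω₀ y f ≤ objective relaxation x)
theorem6p4 R P ω₀ _ y _ b·y≈ω₀ D f =
  fileInequality-valid P ω₀ y D f , fileInequality-bound P ω₀ y D f b·y≈ω₀
  where open CaseDifferentiationProperties R
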